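{- Let $x$ and $y$ be BARTC terms. If $\mathrm{BARTC}\vdash x=y$, then $x\sim_p^{fr}y$ (FR pomset bisimilarity).
   Context: Events. $\langle\mathbb E,\le,\sharp,\lambda\rangle$ is a prime event structure: $\mathbb E$ is a denumerable set of events, $\lambda:\mathbb E\to\Lambda$ a labelling, $\le$ (causality) a partial order with $\{e'\mid e'\le e\}$ finite for every $e$, and $\sharp$ (conflict) an irreflexive symmetric relation such that $e\sharp e'\le e''$ implies $e\sharp e''$. Two events are concurrent if they are related by none of $\le,\ge,\sharp$. For $e\in\mathbb E$, $m\in\mathbb N$, $e[m]$ denotes the past (history) of $e$; $\mathbb E$ is extended by all histories. $X[\mathcal K]$ ($\mathcal K\subseteq\mathbb N$) contains for each $e\in X$ a history $e[m]$ with $m\in\mathcal K$. $X\sim Y$ means $X,Y$ are isomorphic as pomsets (labelled partial orders). Everything is image finite. BARTC terms are built from variables and constants (events $e$ and histories $e[m]$) with the binary operators $\cdot$ (causality) and $+$ (conflict); closed terms have no variables. $Std(x)$: $x$ contains only events, no histories; $NStd(x)$: $x$ contains only histories. $\mathrm{BARTC}\vdash x=y$ means derivability in equational logic from: (A1) $x+y=y+x$; (A2) $(x+y)+z=x+(y+z)$; (A3) $x+x=x$; (A41) $(x+y)\cdot z=x\cdot z+y\cdot z$ if $Std(x),Std(y),Std(z)$; (A42) $x\cdot(y+z)=x\cdot y+x\cdot z$ if $NStd(x),NStd(y),NStd(z)$; (A5) $(x\cdot y)\cdot z=x\cdot(y\cdot z)$. Pomset transitions. $\xrightarrow{X}$ is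 forward, $\overset{X[\mathcal K]}{\twoheadrightarrow}$ is reverse; labels are nonempty pomsets defined by causality $\cdot$ and conflict $+$, and $X\subseteq x$ means the events of $X$ occur in $x$. Forward rules: $X\xrightarrow{X}X[\mathcal K]$; if $x\xrightarrow{X}u$ with $X\subseteq x$ ($u$ is $X[\mathcal K]$ or a term $x'$), then $x+y\xrightarrow{X}u$, $y+x\xrightarrow{X}u$ and $x\cdot y\xrightarrow{X}u\cdot y$. Reverse rules: $X[\mathcal K]\overset{X[\mathcal K]}{\twoheadrightarrow}X$; if $x\overset{X[\mathcal K]}{\twoheadrightarrow}u$ with $X\subseteq x$ ($u$ is $X$ or a term $x'$), then $x+y\overset{X[\mathcal K]}{\twoheadrightarrow}u$, $y+x\overset{X[\mathcal K]}{\twoheadrightarrow}u$ and $y\cdot x\overset{X[\mathcal K]}{\twoheadrightarrow}y\cdot u$. An FR pomset bisimulation is a relation $R$ on states (process terms) such that for $(s,t)\in R$: (1) if $s\xrightarrow{X_1}s'$ then $t\xrightarrow{X_2}t'$ for some $X_2\sim X_1$ and $(s',t')\in R$, and vice versa; (2) if $s\overset{X_1[\mathcal K_1]}{\twoheadrightarrow}s'$ then $t\overset{X_2[\mathcal K_2]}{\twoheadrightarrow}t'$ for some $X_2\sim X_1$ and $\mathcal K_2\subseteq\mathbb N$, with $(s',t')\in R$, and vice versa. $x\sim_p^{fr}y$ iff some FR pomset bisimulation contains $(x,y)$; for terms with variables this is required of all closed substitution instances.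
   Formalization: In the rules X→X[K] and its reverse, pomsets X and X[K] are atomic constants added to the terms, so a composite a·b does not perform the pomset a·b in one step; otherwise A5 fails, since (a·b)·c performs a·b but a·(b·c) cannot. -}

module Defs where

open import Data.Empty using (⊥)
open import Data.List.Base using (List; []; [_]; _++_; map)
open import Data.List.Membership.Propositional using (_∈_)
open import Data.List.Relation.Binary.Subset.Propositional using (_⊆_)
open import Data.Nat.Base using (ℕ)
open import Data.Product.Base using (_×_; _,_; proj₁; Σ-syntax; ∃-syntax)
open import Data.Sum.Base using (_⊎_; inj₁; inj₂)
open import Data.Sum.Relation.Binary.LeftOrder using (_⊎-<_)
open import Data.Sum.Relation.Binary.Pointwise using (Pointwise)
open import Data.Unit.Base using (⊤)
open import Function.Bundles using (_↔_; _⇔_)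
open import Level using (0ℓ)
open import Relation.Binary.Core using (Rel)
open import Relation.Binary.Definitions using (Irreflexive; Symmetric)
open import Relation.Binary.Morphism.Structures using (IsOrderIsomorphism)
open import Relation.Binary.PropositionalEquality.Core using (_≡_)
open import Relation.Binary.Structures using (IsPartialOrder)
import Relation.Unary as U

record PrimeEventStructure (Λ : Set) : Set₁ where
  infix 4 _≤_ _♯_
  field
    Event          : Set
    denumerable    : Event ↔ ℕ
    label          : Event → Λ
    _≤_            : Rel Event 0ℓ
    isPartialOrder : IsPartialOrder _≡_ _≤_
    finiteCauses   : ∀ e → ∃[ es ] (∀ e′ → (e′ ≤ e) ⇔ (e′ ∈ es))
    _♯_            : Rel Event 0ℓ
    ♯-irrefl       : Irreflexive _≡_ _♯_
    ♯-sym          : Symmetric _♯_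
    ♯-hereditary   : ∀ {e e′ e″} → e ♯ e′ → e′ ≤ e″ → e ♯ e″

infixl 7 _·_
infixl 6 _+_

-- Nonempty pomsets given by causality _·_ and conflict _+_, with points
-- decorated by elements of A.
data Pom (A : Set) : Set where
  ⟨_⟩ : A → Pom A
  _·_ : Pom A → Pom A → Pom A
  _+_ : Pom A → Pom A → Pom A

elements : ∀ {A} → Pom A → List A
elements ⟨ a ⟩   = [ a ]
elements (X · Y) = elements X ++ elements Y
elements (X + Y) = elements X ++ elements Y

-- The points of a pomset are occurrences, so an element may occur repeatedly.
Point : ∀ {A} → Pom A → Set
Point ⟨ a ⟩   = ⊤
Point (X · Y) = Point X ⊎ Point Y
Point (X + Y) = Point X ⊎ Point Y

at : ∀ {A} (X : Pom A) → Point X → A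
at ⟨ a ⟩   _        = a
at (X · Y) (inj₁ p) = at X p
at (X · Y) (inj₂ q) = at Y q
at (X + Y) (inj₁ p) = at X p
at (X + Y) (inj₂ q) = at Y q

-- Everything in X causes everything in Y in X · Y; conflicting parts X and Y
-- of X + Y are causally unrelated.
Causes : ∀ {A} (X : Pom A) → Rel (Point X) 0ℓ
Causes ⟨ a ⟩   = _≡_
Causes (X · Y) = Causes X ⊎-< Causes Y
Causes (X + Y) = Pointwise (Causes X) (Causes Y)

module BARTC {Λ : Set} (𝔼 : PrimeEventStructure Λ) where

  open PrimeEventStructure 𝔼 using (Event; label)

  -- (e , m) is the history e[m].
  History : Set
  History = Event × ℕ

  Pomset : Set
  Pomset = Pom Event

  HistoryPomset : Set
  HistoryPomset = Pom History

  infix 4 _∈_⟦_⟧ _∼_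

  -- H ∈ X ⟦ 𝒦 ⟧: H is an instance of X[𝒦], i.e. H replaces each event e of X
  -- by a history e[m] with m in 𝒦.
  data _∈_⟦_⟧ : HistoryPomset → Pomset → U.Pred ℕ 0ℓ → Set₁ where
    ⟨_⟩ : ∀ {𝒦 e m} → m U.∈ 𝒦 → ⟨ e , m ⟩ ∈ ⟨ e ⟩ ⟦ 𝒦 ⟧
    _·_ : ∀ {𝒦 G H X Y} → G ∈ X ⟦ 𝒦 ⟧ → H ∈ Y ⟦ 𝒦 ⟧ → G · H ∈ X · Y ⟦ 𝒦 ⟧
    _+_ : ∀ {𝒦 G H X Y} → G ∈ X ⟦ 𝒦 ⟧ → H ∈ Y ⟦ 𝒦 ⟧ → G + H ∈ X + Y ⟦ 𝒦 ⟧

  _∼_ : Rel Pomset 0ℓ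
  X ∼ Y = Σ[ f ∈ (Point X → Point Y) ]
            IsOrderIsomorphism _≡_ _≡_ (Causes X) (Causes Y) f
            × (∀ p → label (at Y (f p)) ≡ label (at X p))

  -- Terms with variables in V. A pomset X is a process (it performs X and
  -- becomes X[𝒦]) without being the composite of its events: if e₁ · e₂ could
  -- perform the pomset e₁ · e₂ in one step, then so could the left factor of
  -- (e₁ · e₂) · e₃, whereas e₁ · (e₂ · e₃) could not, refuting associativity.
  -- The constants are therefore pomsets of events and pomsets of histories;
  -- the event and history constants are the one-point ones.
  data Term (V : Set) : Set where
    var     : V → Term V
    pomset  : Pomset → Term V
    history : HistoryPomset → Term V
    _·_     : Term V → Term V → Term V
    _+_     : Term V → Term V → Term V

  pattern ev e     = pomset ⟨ e ⟩
  pattern hist e m = history ⟨ e , m ⟩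

  ClosedTerm : Set
  ClosedTerm = Term ⊥

  infixl 8 _⟪_⟫

  _⟪_⟫ : ∀ {V W} → Term V → (V → Term W) → Term W
  var v     ⟪ σ ⟫ = σ v
  pomset X  ⟪ σ ⟫ = pomset X
  history H ⟪ σ ⟫ = history H
  (x · y)   ⟪ σ ⟫ = x ⟪ σ ⟫ · y ⟪ σ ⟫
  (x + y)   ⟪ σ ⟫ = x ⟪ σ ⟫ + y ⟪ σ ⟫

  -- A variable is neither an event nor a history, so it satisfies neither
  -- predicate; both are thus stable under substitution.
  data Std {V : Set} : Term V → Set where
    pomset : ∀ X → Std (pomset X)
    _·_    : ∀ {x y} → Std x → Std y → Std (x · y)
    _+_    : ∀ {x y} → Std x → Std y → Std (x + y)

  data NStd {V : Set} : Term V → Set where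
    history : ∀ H → NStd (history H)
    _·_     : ∀ {x y} → NStd x → NStd y → NStd (x · y)
    _+_     : ∀ {x y} → NStd x → NStd y → NStd (x + y)

  infix 4 ⊢_≈_

  data ⊢_≈_ {V : Set} : Rel (Term V) 0ℓ where
    refl   : ∀ {x} → ⊢ x ≈ x
    sym    : ∀ {x y} → ⊢ x ≈ y → ⊢ y ≈ x
    trans  : ∀ {x y z} → ⊢ x ≈ y → ⊢ y ≈ z → ⊢ x ≈ z
    ·-cong : ∀ {x x′ y y′} → ⊢ x ≈ x′ → ⊢ y ≈ y′ → ⊢ x · y ≈ x′ · y′
    +-cong : ∀ {x x′ y y′} → ⊢ x ≈ x′ → ⊢ y ≈ y′ → ⊢ x + y ≈ x′ + y′
    A1     : ∀ x y → ⊢ x + y ≈ y + x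
    A2     : ∀ x y z → ⊢ (x + y) + z ≈ x + (y + z)
    A3     : ∀ x → ⊢ x + x ≈ x
    A41    : ∀ {x y z} → Std x → Std y → Std z →
             ⊢ (x + y) · z ≈ x · z + y · z
    A42    : ∀ {x y z} → NStd x → NStd y → NStd z →
             ⊢ x · (y + z) ≈ x · y + x · z
    A5     : ∀ x y z → ⊢ (x · y) · z ≈ x · (y · z)

  -- An event occurs in a term as itself or as one of its histories.
  events : ∀ {V} → Term V → List Event
  events (var v)     = []
  events (pomset X)  = elements X
  events (history H) = map proj₁ (elements H)
  events (x · y)     = events x ++ events y
  events (x + y)     = events x ++ events y

  infix 4 _⊑_ _─[_]→_ _─[_,_]↠_

  _⊑_ : ∀ {V} → Pomset → Term V → Set
  X ⊑ x = elements X ⊆ events x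

  data _─[_]→_ : ClosedTerm → Pomset → ClosedTerm → Set₁ where
    act : ∀ {X H 𝒦} → H ∈ X ⟦ 𝒦 ⟧ → pomset X ─[ X ]→ history H
    +ˡ  : ∀ {x y u X} → X ⊑ x → x ─[ X ]→ u → x + y ─[ X ]→ u
    +ʳ  : ∀ {x y u X} → X ⊑ x → x ─[ X ]→ u → y + x ─[ X ]→ u
    ·ˡ  : ∀ {x y u X} → X ⊑ x → x ─[ X ]→ u → x · y ─[ X ]→ u · y

  -- x ─[ X , 𝒦 ]↠ u is the reverse transition labelled X[𝒦].
  data _─[_,_]↠_ : ClosedTerm → Pomset → U.Pred ℕ 0ℓ → ClosedTerm → Set₁ where
    undo : ∀ {X H 𝒦} → H ∈ X ⟦ 𝒦 ⟧ → history H ─[ X , 𝒦 ]↠ pomset X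
    +ˡ   : ∀ {x y u X 𝒦} → X ⊑ x → x ─[ X , 𝒦 ]↠ u → x + y ─[ X , 𝒦 ]↠ u
    +ʳ   : ∀ {x y u X 𝒦} → X ⊑ x → x ─[ X , 𝒦 ]↠ u → y + x ─[ X , 𝒦 ]↠ u
    ·ʳ   : ∀ {x y u X 𝒦} → X ⊑ x → x ─[ X , 𝒦 ]↠ u → y · x ─[ X , 𝒦 ]↠ y · u

  record IsFRPomsetBisimulation (R : Rel ClosedTerm 0ℓ) : Set₁ where
    field
      forward   : ∀ {s t} → R s t → ∀ {X₁ s′} → s ─[ X₁ ]→ s′ →
                  ∃[ X₂ ] ∃[ t′ ] (X₁ ∼ X₂ × t ─[ X₂ ]→ t′ × R s′ t′)
      forward⁻  : ∀ {s t} → R s t → ∀ {X₂ t′} → t ─[ X₂ ]→ t′ →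
                  ∃[ X₁ ] ∃[ s′ ] (X₁ ∼ X₂ × s ─[ X₁ ]→ s′ × R s′ t′)
      backward  : ∀ {s t} → R s t → ∀ {X₁ 𝒦₁ s′} → s ─[ X₁ , 𝒦₁ ]↠ s′ →
                  ∃[ X₂ ] ∃[ 𝒦₂ ] ∃[ t′ ]
                    (X₁ ∼ X₂ × t ─[ X₂ , 𝒦₂ ]↠ t′ × R s′ t′)
      backward⁻ : ∀ {s t} → R s t → ∀ {X₂ 𝒦₂ t′} → t ─[ X₂ , 𝒦₂ ]↠ t′ →
                  ∃[ X₁ ] ∃[ 𝒦₁ ] ∃[ s′ ]
                    (X₁ ∼ X₂ × s ─[ X₁ , 𝒦₁ ]↠ s′ × R s′ t′)

  infix 4 _∼ᶜ_ _∼ₚᶠʳ_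

  _∼ᶜ_ : ClosedTerm → ClosedTerm → Set₁
  s ∼ᶜ t = ∃[ R ] (IsFRPomsetBisimulation R × R s t)

  _∼ₚᶠʳ_ : ∀ {V} → Term V → Term V → Set₁
  x ∼ₚᶠʳ y = ∀ σ → x ⟪ σ ⟫ ∼ᶜ y ⟪ σ ⟫

{-# OPTIONS --safe #-}
-- Provable equality of closed terms is itself an FR pomset bisimulation, in
-- which moves are matched with identical labels. This works because the side
-- condition X ⊑ x of the transition rules is always met, standard terms have
-- no reverse moves (so A41 only concerns forward ones) and history terms have
-- no forward moves (so A42 only concerns reverse ones).
module Submission where

open import Data.List.Base using (map; _++_)
open import Data.List.Properties using (map-++)
open import Data.List.Relation.Binary.Subset.Propositional.Properties
  using (⊆-refl; ⊆-trans; ⊆-reflexive; xs⊆xs++ys; xs⊆ys++xs)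
open import Data.Nat.Base using (ℕ)
open import Data.Product.Base using (_×_; _,_; proj₁; ∃-syntax)
open import Function.Base using (id)
open import Level using (0ℓ)
open import Relation.Binary.Morphism.Construct.Identity
  using (isOrderIsomorphism)
open import Relation.Binary.PropositionalEquality
  using (_≡_; refl; sym; trans; cong₂)
open import Relation.Nullary.Negation using (¬_; contradiction)
import Relation.Unary as U

open import Defs

module _ {Λ : Set} (𝔼 : PrimeEventStructure Λ) where

  open BARTC 𝔼 renaming (refl to ≈-refl; sym to ≈-sym; trans to ≈-trans)

  ∼-refl : ∀ X → X ∼ X
  ∼-refl X = id , isOrderIsomorphism _≡_ _ refl , λ _ → refl

  -- Bisimilarity of open terms quantifies over closed instances, so a derivation is first carried
  -- to closed terms. Only `A41` and `A42` need care, as their side conditions must survive the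
  -- substitution.
  ≈-subst : ∀ {V W} {x y : Term V} (σ : V → Term W) →
            ⊢ x ≈ y → ⊢ x ⟪ σ ⟫ ≈ y ⟪ σ ⟫
  ≈-subst σ ≈-refl            = ≈-refl
  ≈-subst σ (≈-sym p)         = ≈-sym (≈-subst σ p)
  ≈-subst σ (≈-trans p q)     = ≈-trans (≈-subst σ p) (≈-subst σ q)
  ≈-subst σ (·-cong p q)      = ·-cong (≈-subst σ p) (≈-subst σ q)
  ≈-subst σ (+-cong p q)      = +-cong (≈-subst σ p) (≈-subst σ q)
  ≈-subst σ (A1 x y)          = A1 _ _
  ≈-subst σ (A2 x y z)        = A2 _ _ _
  ≈-subst σ (A3 x)            = A3 _
  ≈-subst σ (A41 sx sy sz)    = A41 (Std-subst sx) (Std-subst sy) (Std-subst sz)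
    where
    Std-subst : ∀ {x} → Std x → Std (x ⟪ σ ⟫)
    Std-subst (pomset X) = pomset X
    Std-subst (s · t)    = Std-subst s · Std-subst t
    Std-subst (s + t)    = Std-subst s + Std-subst t
  ≈-subst σ (A42 nx ny nz)    =
    A42 (NStd-subst nx) (NStd-subst ny) (NStd-subst nz)
    where
    NStd-subst : ∀ {x} → NStd x → NStd (x ⟪ σ ⟫)
    NStd-subst (history H) = history H
    NStd-subst (s · t)     = NStd-subst s · NStd-subst t
    NStd-subst (s + t)     = NStd-subst s + NStd-subst t
  ≈-subst σ (A5 x y z)        = A5 _ _ _

  -- Needed for `undo`, where the label lists events but the source is a history constant, whose
  -- events are found by forgetting the keys.
  elements-instance : ∀ {H X 𝒦} → H ∈ X ⟦ 𝒦 ⟧ →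
                      elements X ≡ map proj₁ (elements H)
  elements-instance ⟨ _ ⟩ = refl
  elements-instance (_·_ {G = G} {H} p q) =
    trans (cong₂ _++_ (elements-instance p) (elements-instance q))
          (sym (map-++ proj₁ (elements G) (elements H)))
  elements-instance (_+_ {G = G} {H} p q) =
    trans (cong₂ _++_ (elements-instance p) (elements-instance q))
          (sym (map-++ proj₁ (elements G) (elements H)))

  forward-⊑ : ∀ {x X u} → x ─[ X ]→ u → X ⊑ x
  forward-⊑ (act _)  = ⊆-refl
  forward-⊑ (+ˡ s _) = ⊆-trans s (xs⊆xs++ys _ _)
  forward-⊑ (+ʳ s _) = ⊆-trans s (xs⊆ys++xs _ _)
  forward-⊑ (·ˡ s _) = ⊆-trans s (xs⊆xs++ys _ _)

  reverse-⊑ : ∀ {x X 𝒦 u} → x ─[ X , 𝒦 ]↠ u → X ⊑ x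
  reverse-⊑ (undo h) = ⊆-reflexive (elements-instance h)
  reverse-⊑ (+ˡ s _) = ⊆-trans s (xs⊆xs++ys _ _)
  reverse-⊑ (+ʳ s _) = ⊆-trans s (xs⊆ys++xs _ _)
  reverse-⊑ (·ʳ s _) = ⊆-trans s (xs⊆ys++xs _ _)


  module _ {X : Pomset} where

    →+ˡ : ∀ {x y u} → x ─[ X ]→ u → x + y ─[ X ]→ u
    →+ˡ a = +ˡ (forward-⊑ a) a

    →+ʳ : ∀ {x y u} → x ─[ X ]→ u → y + x ─[ X ]→ u
    →+ʳ a = +ʳ (forward-⊑ a) a

    →·ˡ : ∀ {x y u} → x ─[ X ]→ u → x · y ─[ X ]→ u · y
    →·ˡ a = ·ˡ (forward-⊑ a) a

    -- A forward move descends through summands and left factors until it reaches a constant, and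
    -- `act` never applies to a history constant.
    NStd-stuck : ∀ {x u} → NStd x → ¬ x ─[ X ]→ u
    NStd-stuck (n · _) (·ˡ _ a) = NStd-stuck n a
    NStd-stuck (n + _) (+ˡ _ a) = NStd-stuck n a
    NStd-stuck (_ + n) (+ʳ _ a) = NStd-stuck n a

    -- Induction on the derivation, simultaneous with the converse direction because `≈-sym`
    -- exchanges the two sides. The label `X` stays fixed. Among the axioms, only `A5` leaves
    -- residuals that are not syntactically equal.
    ≈-forward : ∀ {x y} → ⊢ x ≈ y → ∀ {u} → x ─[ X ]→ u →
                ∃[ v ] (y ─[ X ]→ v × ⊢ u ≈ v)
    ≈-forward⁻ : ∀ {x y} → ⊢ x ≈ y → ∀ {v} → y ─[ X ]→ v →
                 ∃[ u ] (x ─[ X ]→ u × ⊢ u ≈ v)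

    ≈-forward ≈-refl a = _ , a , ≈-refl
    ≈-forward (≈-sym p) a =
      let _ , b , q = ≈-forward⁻ p a in _ , b , ≈-sym q
    ≈-forward (≈-trans p q) a =
      let _ , b , r = ≈-forward p a
          _ , c , s = ≈-forward q b
      in _ , c , ≈-trans r s
    -- The right factor stays idle, so `q` serves only to equate the residuals.
    ≈-forward (·-cong p q) (·ˡ _ a) =
      let _ , b , r = ≈-forward p a in _ , →·ˡ b , ·-cong r q
    ≈-forward (+-cong p q) (+ˡ _ a) =
      let _ , b , r = ≈-forward p a in _ , →+ˡ b , r
    ≈-forward (+-cong p q) (+ʳ _ a) =
      let _ , b , r = ≈-forward q a in _ , →+ʳ b , r
    ≈-forward (A1 x y) (+ˡ _ a) = _ , →+ʳ a , ≈-refl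
    ≈-forward (A1 x y) (+ʳ _ a) = _ , →+ˡ a , ≈-refl
    ≈-forward (A2 x y z) (+ˡ _ (+ˡ _ a)) = _ , →+ˡ a , ≈-refl
    ≈-forward (A2 x y z) (+ˡ _ (+ʳ _ a)) = _ , →+ʳ (→+ˡ a) , ≈-refl
    ≈-forward (A2 x y z) (+ʳ _ a) = _ , →+ʳ (→+ʳ a) , ≈-refl
    ≈-forward (A3 x) (+ˡ _ a) = _ , a , ≈-refl
    ≈-forward (A3 x) (+ʳ _ a) = _ , a , ≈-refl
    ≈-forward (A41 _ _ _) (·ˡ _ (+ˡ _ a)) = _ , →+ˡ (→·ˡ a) , ≈-refl
    ≈-forward (A41 _ _ _) (·ˡ _ (+ʳ _ a)) = _ , →+ʳ (→·ˡ a) , ≈-refl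
    -- A forward move here would keep `y + z` whole on one side but only one of `y` and `z` on the
    -- other. It cannot occur: it would start in the left factor, which consists of histories.
    ≈-forward (A42 n _ _) (·ˡ _ a) = contradiction a (NStd-stuck n)
    ≈-forward (A5 x y z) (·ˡ _ (·ˡ _ a)) = _ , →·ˡ a , A5 _ _ _

    ≈-forward⁻ ≈-refl a = _ , a , ≈-refl
    ≈-forward⁻ (≈-sym p) a =
      let _ , b , q = ≈-forward p a in _ , b , ≈-sym q
    ≈-forward⁻ (≈-trans p q) a =
      let _ , b , s = ≈-forward⁻ q a
          _ , c , r = ≈-forward⁻ p b
      in _ , c , ≈-trans r s
    ≈-forward⁻ (·-cong p q) (·ˡ _ a) =
      let _ , b , r = ≈-forward⁻ p a in _ , →·ˡ b , ·-cong r q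
    ≈-forward⁻ (+-cong p q) (+ˡ _ a) =
      let _ , b , r = ≈-forward⁻ p a in _ , →+ˡ b , r
    ≈-forward⁻ (+-cong p q) (+ʳ _ a) =
      let _ , b , r = ≈-forward⁻ q a in _ , →+ʳ b , r
    ≈-forward⁻ (A1 x y) (+ˡ _ a) = _ , →+ʳ a , ≈-refl
    ≈-forward⁻ (A1 x y) (+ʳ _ a) = _ , →+ˡ a , ≈-refl
    ≈-forward⁻ (A2 x y z) (+ˡ _ a) = _ , →+ˡ (→+ˡ a) , ≈-refl
    ≈-forward⁻ (A2 x y z) (+ʳ _ (+ˡ _ a)) = _ , →+ˡ (→+ʳ a) , ≈-refl
    ≈-forward⁻ (A2 x y z) (+ʳ _ (+ʳ _ a)) = _ , →+ʳ a , ≈-refl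
    ≈-forward⁻ (A3 x) a = _ , →+ˡ a , ≈-refl
    ≈-forward⁻ (A41 _ _ _) (+ˡ _ (·ˡ _ a)) = _ , →·ˡ (→+ˡ a) , ≈-refl
    ≈-forward⁻ (A41 _ _ _) (+ʳ _ (·ˡ _ a)) = _ , →·ˡ (→+ʳ a) , ≈-refl
    ≈-forward⁻ (A42 n _ _) (+ˡ _ (·ˡ _ a)) = contradiction a (NStd-stuck n)
    ≈-forward⁻ (A42 n _ _) (+ʳ _ (·ˡ _ a)) = contradiction a (NStd-stuck n)
    ≈-forward⁻ (A5 x y z) (·ˡ _ a) = _ , →·ˡ (→·ˡ a) , A5 _ _ _

  module _ {X : Pomset} {𝒦 : U.Pred ℕ 0ℓ} where

    ↠+ˡ : ∀ {x y u} → x ─[ X , 𝒦 ]↠ u → x + y ─[ X , 𝒦 ]↠ u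
    ↠+ˡ a = +ˡ (reverse-⊑ a) a

    ↠+ʳ : ∀ {x y u} → x ─[ X , 𝒦 ]↠ u → y + x ─[ X , 𝒦 ]↠ u
    ↠+ʳ a = +ʳ (reverse-⊑ a) a

    ↠·ʳ : ∀ {x y u} → x ─[ X , 𝒦 ]↠ u → y · x ─[ X , 𝒦 ]↠ y · u
    ↠·ʳ a = ·ʳ (reverse-⊑ a) a

    -- Dual to `NStd-stuck`: a reverse move descends through summands and right factors, and `undo`
    -- never applies to a `pomset` constant.
    Std-stuck : ∀ {x u} → Std x → ¬ x ─[ X , 𝒦 ]↠ u
    Std-stuck (_ · s) (·ʳ _ a) = Std-stuck s a
    Std-stuck (s + _) (+ˡ _ a) = Std-stuck s a
    Std-stuck (_ + s) (+ʳ _ a) = Std-stuck s a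

    -- The mirror image of `≈-forward`: products now move in their right factor, so `A41` and `A42`
    -- exchange roles, and in `·-cong` it is the left factor that stays idle.
    ≈-reverse : ∀ {x y} → ⊢ x ≈ y → ∀ {u} → x ─[ X , 𝒦 ]↠ u →
                ∃[ v ] (y ─[ X , 𝒦 ]↠ v × ⊢ u ≈ v)
    ≈-reverse⁻ : ∀ {x y} → ⊢ x ≈ y → ∀ {v} → y ─[ X , 𝒦 ]↠ v →
                 ∃[ u ] (x ─[ X , 𝒦 ]↠ u × ⊢ u ≈ v)

    ≈-reverse ≈-refl a = _ , a , ≈-refl
    ≈-reverse (≈-sym p) a =
      let _ , b , q = ≈-reverse⁻ p a in _ , b , ≈-sym q
    ≈-reverse (≈-trans p q) a =
      let _ , b , r = ≈-reverse p a
          _ , c , s = ≈-reverse q b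
      in _ , c , ≈-trans r s
    ≈-reverse (·-cong p q) (·ʳ _ a) =
      let _ , b , r = ≈-reverse q a in _ , ↠·ʳ b , ·-cong p r
    ≈-reverse (+-cong p q) (+ˡ _ a) =
      let _ , b , r = ≈-reverse p a in _ , ↠+ˡ b , r
    ≈-reverse (+-cong p q) (+ʳ _ a) =
      let _ , b , r = ≈-reverse q a in _ , ↠+ʳ b , r
    ≈-reverse (A1 x y) (+ˡ _ a) = _ , ↠+ʳ a , ≈-refl
    ≈-reverse (A1 x y) (+ʳ _ a) = _ , ↠+ˡ a , ≈-refl
    ≈-reverse (A2 x y z) (+ˡ _ (+ˡ _ a)) = _ , ↠+ˡ a , ≈-refl
    ≈-reverse (A2 x y z) (+ˡ _ (+ʳ _ a)) = _ , ↠+ʳ (↠+ˡ a) , ≈-refl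
    ≈-reverse (A2 x y z) (+ʳ _ a) = _ , ↠+ʳ (↠+ʳ a) , ≈-refl
    ≈-reverse (A3 x) (+ˡ _ a) = _ , a , ≈-refl
    ≈-reverse (A3 x) (+ʳ _ a) = _ , a , ≈-refl
    -- `s` says that the common right factor `z` is standard, and a reverse move of the product
    -- would have to start there.
    ≈-reverse (A41 _ _ s) (·ʳ _ a) = contradiction a (Std-stuck s)
    ≈-reverse (A42 _ _ _) (·ʳ _ (+ˡ _ a)) = _ , ↠+ˡ (↠·ʳ a) , ≈-refl
    ≈-reverse (A42 _ _ _) (·ʳ _ (+ʳ _ a)) = _ , ↠+ʳ (↠·ʳ a) , ≈-refl
    ≈-reverse (A5 x y z) (·ʳ _ a) = _ , ↠·ʳ (↠·ʳ a) , A5 _ _ _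

    ≈-reverse⁻ ≈-refl a = _ , a , ≈-refl
    ≈-reverse⁻ (≈-sym p) a =
      let _ , b , q = ≈-reverse p a in _ , b , ≈-sym q
    ≈-reverse⁻ (≈-trans p q) a =
      let _ , b , s = ≈-reverse⁻ q a
          _ , c , r = ≈-reverse⁻ p b
      in _ , c , ≈-trans r s
    ≈-reverse⁻ (·-cong p q) (·ʳ _ a) =
      let _ , b , r = ≈-reverse⁻ q a in _ , ↠·ʳ b , ·-cong p r
    ≈-reverse⁻ (+-cong p q) (+ˡ _ a) =
      let _ , b , r = ≈-reverse⁻ p a in _ , ↠+ˡ b , r
    ≈-reverse⁻ (+-cong p q) (+ʳ _ a) =
      let _ , b , r = ≈-reverse⁻ q a in _ , ↠+ʳ b , r
    ≈-reverse⁻ (A1 x y) (+ˡ _ a) = _ , ↠+ʳ a , ≈-refl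
    ≈-reverse⁻ (A1 x y) (+ʳ _ a) = _ , ↠+ˡ a , ≈-refl
    ≈-reverse⁻ (A2 x y z) (+ˡ _ a) = _ , ↠+ˡ (↠+ˡ a) , ≈-refl
    ≈-reverse⁻ (A2 x y z) (+ʳ _ (+ˡ _ a)) = _ , ↠+ˡ (↠+ʳ a) , ≈-refl
    ≈-reverse⁻ (A2 x y z) (+ʳ _ (+ʳ _ a)) = _ , ↠+ʳ a , ≈-refl
    ≈-reverse⁻ (A3 x) a = _ , ↠+ˡ a , ≈-refl
    ≈-reverse⁻ (A41 _ _ s) (+ˡ _ (·ʳ _ a)) = contradiction a (Std-stuck s)
    ≈-reverse⁻ (A41 _ _ s) (+ʳ _ (·ʳ _ a)) = contradiction a (Std-stuck s)
    ≈-reverse⁻ (A42 _ _ _) (+ˡ _ (·ʳ _ a)) = _ , ↠·ʳ (↠+ˡ a) , ≈-refl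
    ≈-reverse⁻ (A42 _ _ _) (+ʳ _ (·ʳ _ a)) = _ , ↠·ʳ (↠+ʳ a) , ≈-refl
    ≈-reverse⁻ (A5 x y z) (·ʳ _ (·ʳ _ a)) = _ , ↠·ʳ a , A5 _ _ _

  ≈-isFRPomsetBisimulation : IsFRPomsetBisimulation ⊢_≈_
  ≈-isFRPomsetBisimulation = record
    -- The matching label is the given one, found by unification, so the required pomset isomorphism
    -- is the identity.
    { forward   = λ p a → _ , let v , r = ≈-forward p a in v , ∼-refl _ , r
    ; forward⁻  = λ p a → _ , let u , r = ≈-forward⁻ p a in u , ∼-refl _ , r
    ; backward  = λ p a → _ , _ , let v , r = ≈-reverse p a in v , ∼-refl _ , r
    ; backward⁻ = λ p a → _ , _ , let u , r = ≈-reverse⁻ p a in u , ∼-refl _ , r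
    }

theorem3p4 : {Λ : Set} (𝔼 : PrimeEventStructure Λ) → let open BARTC 𝔼 in
    {V : Set} (x y : Term V) → ⊢ x ≈ y → x ∼ₚᶠʳ y
theorem3p4 𝔼 x y p σ =
  -- One relation, provable equality of closed terms, serves for every `x`, `y` and `σ`.
  BARTC.⊢_≈_ 𝔼 , ≈-isFRPomsetBisimulation 𝔼 , ≈-subst 𝔼 σ p
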